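{- If $G$ is an oriented hypergraph with all adjacencies negative and $u_1,u_2,w_1,w_2$ are vertices, then \[[u_1u_2,w_1w_2]_P=(-1)^{|V|}\,\big|\widehat{\mathfrak{C}}_{\neq0}(L^0(G);u_1u_2,w_1w_2)\big|.\]
   Context: An oriented hypergraph $G$ consists of finite sets $V$ (vertices), $E$ (edges), $I$ (incidences), maps $\varsigma:I\to V$, $\omega:I\to E$ and an orientation $\sigma:I\to\{+1,-1\}$. An adjacency is an ordered pair $(i,j)$ of distinct incidences with $\omega(i)=\omega(j)$, from $\varsigma(i)$ to $\varsigma(j)$, with sign $-\sigma(i)\sigma(j)$; a backstep at $v$ is the step $v,i,\omega(i),i,v$ with $\varsigma(i)=v$. $\widehat{\mathfrak{C}}_{\neq0}(L^0(G);u_1u_2,w_1w_2)$ is the set of assignments $c$ choosing, for each $v\in V\setminus\{u_1,u_2\}$, an adjacency of $G$ starting at $v$ or a backstep at $v$, such that the rule $\pi_c(v)=$ head of the step at $v$ ($v\notin\{u_1,u_2\}$), $\pi_c(u_1)=w_1$, $\pi_c(u_2)=w_2$, defines a bijection of $V$. $bs(c)$ is the number of backsteps of $c$; $nc(c)$ the number of components of $c$ (connected components of the graph formed by the steps of $c$) with product of adjacency signs $-1$; $\mathrm{sgn}_P(c)=(-1)^{nc(c)+bs(c)}$; and $[u_1u_2,w_1w_2]_P=\sum_{c\in\widehat{\mathfrak{C}}_{\neq0}(L^0(G);u_1u_2,w_1w_2)}\mathrm{sgn}_P(c)$. -}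

module Defs where

open import Data.Nat as ℕ using (ℕ; zero; suc)
open import Data.Fin as F using (Fin; zero; suc; _≟_; _<?_)
open import Data.Fin.Properties using (all?; any?)
open import Data.Bool using (Bool; true; false; _∧_; _∨_; not; if_then_else_)
open import Data.List as L using (List; []; _∷_; _++_; concatMap; filter; filterᵇ; allFin; cartesianProductWith; length)
open import Data.Bool.ListAction using () renaming (any to anyᵇ)
open import Data.Maybe using (Maybe; just; nothing)
open import Data.Product using (Σ; ∃; _×_; _,_)
open import Data.Sign as S using (Sign)
open import Data.Integer as Z using (ℤ; -1ℤ; 0ℤ; 1ℤ)
open import Data.Vec.Functional using (Vector) renaming (_∷_ to _◂_)
open import Relation.Binary.PropositionalEquality using (_≡_; _≢_)
open import Relation.Nullary using (Dec; ¬_; yes; no)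
open import Relation.Nullary.Decidable using (⌊_⌋; _×-dec_; _→-dec_; ¬?)
open import Relation.Unary using (Decidable)

-- An oriented hypergraph: V = Fin nV, E = Fin nE, I = Fin nI,
-- ς : I → V, ω : I → E, σ : I → {+1,-1}.
record OrientedHypergraph : Set where
  field
    nV nE nI : ℕ
    ς : Fin nI → Fin nV
    ω : Fin nI → Fin nE
    σ : Fin nI → Sign

open OrientedHypergraph public

-- A step: an adjacency (i , j) or a backstep along incidence i.
data Step (n : ℕ) : Set where
  adj  : Fin n → Fin n → Step n
  back : Fin n → Step n

-- ordered enumeration of all lists of choices: one element of L v for each v
choiceFunctions : ∀ {n} {A : Set} → (Fin n → List A) → List (Vector A n)
choiceFunctions {zero}  Ls = (λ ()) ∷ []
choiceFunctions {suc n} Ls =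
  concatMap (λ a → L.map (λ f → a ◂ f) (choiceFunctions (λ k → Ls (suc k)))) (Ls zero)

module _ (G : OrientedHypergraph) where

  -- (i , j) is an adjacency: distinct incidences on the same edge
  IsAdjacency : Fin (nI G) → Fin (nI G) → Set
  IsAdjacency i j = i ≢ j × ω G i ≡ ω G j

  -- sign of the adjacency (i , j) : - σ(i) σ(j)
  adjSign : Fin (nI G) → Fin (nI G) → Sign
  adjSign i j = S.opposite (σ G i S.* σ G j)

  AllAdjacenciesNegative : Set
  AllAdjacenciesNegative = ∀ i j → IsAdjacency i j → adjSign i j ≡ S.-

  -- s is an adjacency starting at v, or a backstep at v
  IsStepAt : Fin (nV G) → Step (nI G) → Set
  IsStepAt v (adj i j) = ς G i ≡ v × IsAdjacency i j
  IsStepAt v (back i)  = ς G i ≡ v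

  isStepAt? : (v : Fin (nV G)) → Decidable (IsStepAt v)
  isStepAt? v (adj i j) = (ς G i ≟ v) ×-dec (¬? (i ≟ j) ×-dec (ω G i ≟ ω G j))
  isStepAt? v (back i)  = ς G i ≟ v

  -- head of a step
  head : Step (nI G) → Fin (nV G)
  head (adj i j) = ς G j
  head (back i)  = ς G i

  allSteps : List (Step (nI G))
  allSteps = cartesianProductWith adj (allFin (nI G)) (allFin (nI G)) L.++ L.map back (allFin (nI G))

  stepsAt : Fin (nV G) → List (Step (nI G))
  stepsAt v = filter (isStepAt? v) allSteps

  -- An assignment: a step at each vertex (nothing at u₁, u₂).
  Assignment : Set
  Assignment = Fin (nV G) → Maybe (Step (nI G))

  module _ (u₁ u₂ w₁ w₂ : Fin (nV G)) where

    isSpecial : Fin (nV G) → Bool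
    isSpecial v = ⌊ v ≟ u₁ ⌋ ∨ ⌊ v ≟ u₂ ⌋

    -- all assignments choosing, for every v ∉ {u₁,u₂}, a step at v
    allAssignments : List Assignment
    allAssignments = choiceFunctions
      (λ v → if isSpecial v then nothing ∷ [] else L.map just (stepsAt v))

    -- π_c
    π : Assignment → Fin (nV G) → Fin (nV G)
    π c v with v ≟ u₁ | v ≟ u₂ | c v
    ... | yes _ | _         | _      = w₁
    ... | no _  | yes _ | _      = w₂
    ... | no _  | no _  | just s = head s
    ... | no _  | no _  | nothing = v

    IsBijection : (Fin (nV G) → Fin (nV G)) → Set
    IsBijection f = (∀ x y → f x ≡ f y → x ≡ y) × (∀ y → ∃ λ x → f x ≡ y)

    isBijection? : (f : Fin (nV G) → Fin (nV G)) → Dec (IsBijection f)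
    isBijection? f =
      all? (λ x → all? (λ y → (f x ≟ f y) →-dec (x ≟ y)))
      ×-dec all? (λ y → any? (λ x → f x ≟ y))

    -- Ĉ_{≠0}(L⁰(G); u₁u₂, w₁w₂)
    Ĉ : List Assignment
    Ĉ = filter (λ c → isBijection? (π c)) allAssignments

    ----------------------------------------------------------------
    -- sign of an assignment

    isBack : Maybe (Step (nI G)) → Bool
    isBack (just (back _)) = true
    isBack _               = false

    count : (Fin (nV G) → Bool) → ℕ
    count p = length (filterᵇ p (allFin (nV G)))

    bs : Assignment → ℕ
    bs c = count (λ v → isBack (c v))

    -- c has a step from x to y
    stepTo : Assignment → Fin (nV G) → Fin (nV G) → Bool
    stepTo c x y with c x
    ... | just s  = ⌊ head s ≟ y ⌋
    ... | nothing = false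

    -- x and y are joined by a step of c (undirected)
    joined : Assignment → Fin (nV G) → Fin (nV G) → Bool
    joined c x y = stepTo c x y ∨ stepTo c y x

    -- reachable by a path of at most k steps of c
    reach : Assignment → ℕ → Fin (nV G) → Fin (nV G) → Bool
    reach c zero    x y = ⌊ x ≟ y ⌋
    reach c (suc k) x y =
      reach c k x y ∨ anyᵇ (λ z → reach c k x z ∧ joined c z y) (allFin (nV G))

    -- same connected component of the graph formed by the steps of c
    connected : Assignment → Fin (nV G) → Fin (nV G) → Bool
    connected c = reach c (nV G)

    -- x is the least vertex of its component (component representative)
    isRep : Assignment → Fin (nV G) → Bool
    isRep c x = not (anyᵇ (λ y → ⌊ y <? x ⌋ ∧ connected c x y) (allFin (nV G)))

    stepSign : Maybe (Step (nI G)) → Sign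
    stepSign (just (adj i j)) = adjSign i j
    stepSign _                = S.+

    -- product of the adjacency signs in the component of x
    compSign : Assignment → Fin (nV G) → Sign
    compSign c x = L.foldr S._*_ S.+
      (L.map (λ y → stepSign (c y)) (filterᵇ (connected c x) (allFin (nV G))))

    isNeg : Sign → Bool
    isNeg S.- = true
    isNeg S.+ = false

    -- number of components with sign -1
    nc : Assignment → ℕ
    nc c = count (λ x → isRep c x ∧ isNeg (compSign c x))

    sgnP : Assignment → ℤ
    sgnP c = -1ℤ Z.^ (nc c ℕ.+ bs c)

    -- [u₁u₂, w₁w₂]_P
    bracketP : ℤ
    bracketP = L.foldr Z._+_ 0ℤ (L.map sgnP Ĉ)

{-# OPTIONS --safe #-}

-- Fix an assignment c. Grouping the adjacency signs of c by component, (-1)^nc(c) is the product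
-- of the signs of all steps of c, so (-1)^(nc(c) + bs(c)) is the product over v ∉ {u₁, u₂} of the
-- sign of the step at v, negated when that step is a backstep. If all adjacencies are negative,
-- each of these |V| - 2 factors is -1, so every c has sgn_P(c) = (-1)^|V| and the bracket is
-- (-1)^|V| |Ĉ|. A component is represented by its least vertex; connectivity within |V| steps is
-- transitive because the set reached within k steps grows strictly until it stops changing.

module Submission where

open import Defs
open import Data.Fin using (Fin)
open import Data.List using (length)
open import Data.Integer using (ℤ; -1ℤ; +_; _*_; _^_)
open import Relation.Binary.PropositionalEquality using (_≡_; _≢_)

open import Data.Bool using (Bool; true; false; T; _∧_; _∨_; if_then_else_)
import Data.Bool.Properties as BoolP
open import Data.Bool.Properties using (T-∧; T-∨; T-≡; T-not-≡)
open import Data.Bool.ListAction using (or) renaming (any to anyᵇ)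
open import Data.Empty using (⊥-elim)
open import Data.Fin as Fin using (zero; suc; _≟_; _<?_)
import Data.Fin.Properties as FinP
open import Data.Fin.Induction using (<-wellFounded)
open import Data.Integer as ℤ using (0ℤ; 1ℤ; _◃_)
import Data.Integer.Properties as ℤP
open import Data.List as List using (List; []; _∷_; allFin; filterᵇ; foldr; map)
import Data.List.Properties as ListP
open import Data.List.Membership.Propositional using (_∈_; lose)
open import Data.List.Membership.Propositional.Properties using (∈-allFin)
open import Data.List.Relation.Unary.All as All using (All; []; _∷_)
import Data.List.Relation.Unary.All.Properties as AllP
open import Data.List.Relation.Unary.Any using (here; there; satisfied)
open import Data.List.Relation.Unary.Any.Properties using (any⁺; any⁻)
open import Data.Maybe using (Maybe; just; nothing)
open import Data.Nat as ℕ using (ℕ; zero; suc; z≤n; s≤s)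
import Data.Nat.Properties as ℕP
open import Data.Product using (∃; _×_; _,_)
open import Data.Sign as Sign using (Sign)
import Data.Sign.Properties as SignP
open import Data.Sum using (_⊎_; inj₁; inj₂)
open import Data.Vec.Functional using (removeAt) renaming (_∷_ to _◂_)
open import Function using (_∘_; id; const)
open import Function.Bundles using (Equivalence)
open import Induction.WellFounded using (Acc; acc)
open import Relation.Binary.Definitions using (tri<; tri≈; tri>)
open import Relation.Binary.PropositionalEquality
  using (refl; sym; trans; cong; cong₂; subst; _≗_; module ≡-Reasoning)
open import Relation.Nullary using (¬_; yes; no)
open import Relation.Nullary.Decidable using (⌊_⌋; toWitness; fromWitness; T?; _×-dec_)

open Equivalence using (to; from)

open import Algebra.Properties.CommutativeMonoid.Sum SignP.*-commutativeMonoid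
  using ()
  renaming ( sum to ∏; sum-cong-≗ to ∏-cong; ∑-distrib-+ to ∏-distrib; ∑-comm to ∏-comm
           ; sum-remove to ∏-remove; sum-replicate to ∏-replicate
           ; sum-replicate-zero to ∏-replicate-+)
-- In the multiplicative monoid of signs, k · s is the power s^k.
open import Algebra.Properties.Monoid.Mult SignP.*-monoid
  using () renaming (_×_ to _·_; ×-homo-+ to ·-homo-+)

if-T : ∀ {A : Set} {b} {x y : A} → T b → (if b then x else y) ≡ x
if-T {b = true} _ = refl

if-¬T : ∀ {A : Set} {b} {x y : A} → ¬ T b → (if b then x else y) ≡ y
if-¬T {b = true}  ¬b = ⊥-elim (¬b _)
if-¬T {b = false} _  = refl

∏ᴸ : List Sign → Sign
∏ᴸ = foldr Sign._*_ Sign.+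

∏ᴸ-map-filterᵇ : ∀ {A : Set} (p : A → Bool) (f : A → Sign) xs →
  ∏ᴸ (map f (filterᵇ p xs)) ≡ ∏ᴸ (map (λ x → if p x then f x else Sign.+) xs)
∏ᴸ-map-filterᵇ p f [] = refl
∏ᴸ-map-filterᵇ p f (x ∷ xs) with p x
... | true  = cong (f x Sign.*_) (∏ᴸ-map-filterᵇ p f xs)
... | false = ∏ᴸ-map-filterᵇ p f xs

∏ᴸ-tabulate : ∀ {n} (f : Fin n → Sign) → ∏ᴸ (List.tabulate f) ≡ ∏ f
∏ᴸ-tabulate {zero}  f = refl
∏ᴸ-tabulate {suc n} f = cong (f zero Sign.*_) (∏ᴸ-tabulate (f ∘ suc))

∏ᴸ-filterᵇ-allFin : ∀ {n} (p : Fin n → Bool) (f : Fin n → Sign) →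
  ∏ᴸ (map f (filterᵇ p (allFin n))) ≡ ∏ (λ x → if p x then f x else Sign.+)
∏ᴸ-filterᵇ-allFin {n} p f = begin
  ∏ᴸ (map f (filterᵇ p (allFin n)))  ≡⟨ ∏ᴸ-map-filterᵇ p f (allFin n) ⟩
  ∏ᴸ (map g (allFin n))              ≡⟨ cong ∏ᴸ (ListP.map-tabulate id g) ⟩
  ∏ᴸ (List.tabulate g)               ≡⟨ ∏ᴸ-tabulate g ⟩
  ∏ g                                ∎
  where
  open ≡-Reasoning
  g : Fin n → Sign
  g x = if p x then f x else Sign.+

length-· : ∀ {A : Set} (s : Sign) (xs : List A) → length xs · s ≡ ∏ᴸ (map (const s) xs)
length-· s []       = refl
length-· s (x ∷ xs) = cong (s Sign.*_) (length-· s xs)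

count-parity : ∀ {n} (p : Fin n → Bool) →
  length (filterᵇ p (allFin n)) · Sign.- ≡ ∏ (λ x → if p x then Sign.- else Sign.+)
count-parity {n} p =
  trans (length-· Sign.- (filterᵇ p (allFin n))) (∏ᴸ-filterᵇ-allFin p (const Sign.-))

∏-single : ∀ {n} (P : Fin n → Bool) (s : Sign) {m} → T (P m) → (∀ x → T (P x) → x ≡ m) →
  ∏ (λ x → if P x then s else Sign.+) ≡ s
∏-single {suc n} P s {m} Pm unique = begin
  ∏ f                           ≡⟨ ∏-remove {i = m} f ⟩
  f m Sign.* ∏ (removeAt f m)   ≡⟨ cong₂ Sign._*_ (if-T Pm) (trans (∏-cong others) (∏-replicate-+ n)) ⟩
  s Sign.* Sign.+               ≡⟨ SignP.*-identityʳ s ⟩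
  s                             ∎
  where
  open ≡-Reasoning
  f : Fin (suc n) → Sign
  f x = if P x then s else Sign.+
  others : removeAt f m ≗ const Sign.+
  others i = if-¬T (λ p → FinP.punchInᵢ≢i m i (unique _ p))

-1^≡◃ : ∀ k → -1ℤ ^ k ≡ (k · Sign.-) ◃ 1
-1^≡◃ zero    = refl
-1^≡◃ (suc k) = trans (cong (-1ℤ *_) (-1^≡◃ k)) (sym (ℤP.◃-distrib-* Sign.- (k · Sign.-) 1 1))

sum-const : ∀ {A : Set} (f : A → ℤ) {s xs} → All (λ x → f x ≡ s) xs →
  foldr ℤ._+_ 0ℤ (map f xs) ≡ s * + length xs
sum-const f {s} []       = sym (ℤP.*-zeroʳ s)
sum-const f {s} {_ ∷ xs} (fx≡s ∷ rest) = begin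
  f _ ℤ.+ foldr ℤ._+_ 0ℤ (map f xs)  ≡⟨ cong₂ ℤ._+_ fx≡s (sum-const f rest) ⟩
  s ℤ.+ s * + length xs              ≡⟨ cong (ℤ._+ s * + length xs) (ℤP.*-identityʳ s) ⟨
  s * 1ℤ ℤ.+ s * + length xs         ≡⟨ ℤP.*-distribˡ-+ s 1ℤ (+ length xs) ⟨
  s * + suc (length xs)              ∎
  where open ≡-Reasoning

choiceFunctions-All : ∀ {n} {A : Set} {Ls : Fin n → List A} {Q : Fin n → A → Set} →
  (∀ k → All (Q k) (Ls k)) → All (λ f → ∀ k → Q k (f k)) (choiceFunctions Ls)
choiceFunctions-All {zero}  _ = (λ ()) ∷ []
choiceFunctions-All {suc n} {Ls = Ls} {Q} h = AllP.concat⁺ (AllP.map⁺ (All.map extend (h zero)))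
  where
  extend : ∀ {a} → Q zero a →
    All (λ f → ∀ k → Q k (f k)) (map (λ f → a ◂ f) (choiceFunctions (λ k → Ls (suc k))))
  extend Qa = AllP.map⁺ (All.map (λ Qf → λ { zero → Qa ; (suc k) → Qf k })
                                 (choiceFunctions-All (h ∘ suc)))

length-filterᵇ-mono : ∀ {A : Set} {p q : A → Bool} → (∀ x → T (p x) → T (q x)) →
  ∀ xs → length (filterᵇ p xs) ℕ.≤ length (filterᵇ q xs)
length-filterᵇ-mono         p⊆q []       = z≤n
length-filterᵇ-mono {p = p} {q} p⊆q (x ∷ xs) with p x in px | q x in qx
... | true  | true  = s≤s (length-filterᵇ-mono p⊆q xs)
... | true  | false = ⊥-elim (subst T qx (p⊆q x (subst T (sym px) _)))
... | false | true  = ℕP.m≤n⇒m≤1+n (length-filterᵇ-mono p⊆q xs)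
... | false | false = length-filterᵇ-mono p⊆q xs

length-filterᵇ-strict : ∀ {A : Set} {p q : A → Bool} → (∀ x → T (p x) → T (q x)) →
  ∀ {xs y} → y ∈ xs → ¬ T (p y) → T (q y) → length (filterᵇ p xs) ℕ.< length (filterᵇ q xs)
length-filterᵇ-strict {p = p} {q} p⊆q {y ∷ xs} (here refl) ¬py qy with p y | q y
... | true  | _     = ⊥-elim (¬py _)
... | false | true  = s≤s (length-filterᵇ-mono p⊆q xs)
... | false | false = ⊥-elim qy
length-filterᵇ-strict {p = p} {q} p⊆q {x ∷ xs} (there y∈xs) ¬py qy with p x in px | q x in qx
... | true  | true  = s≤s (length-filterᵇ-strict p⊆q y∈xs ¬py qy)
... | true  | false = ⊥-elim (subst T qx (p⊆q x (subst T (sym px) _)))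
... | false | true  = ℕP.m<n⇒m<1+n (length-filterᵇ-strict p⊆q y∈xs ¬py qy)
... | false | false = length-filterᵇ-strict p⊆q y∈xs ¬py qy

bool-strict-increase : ∀ a b → b ≢ a → (T a → T b) → ¬ T a × T b
bool-strict-increase true  true  b≢a _     = ⊥-elim (b≢a refl)
bool-strict-increase true  false _   a⇒b   = ⊥-elim (a⇒b _)
bool-strict-increase false true  _   _     = (λ ()) , _
bool-strict-increase false false b≢a _     = ⊥-elim (b≢a refl)

module IncreasingSubsets {n : ℕ} (S : ℕ → Fin n → Bool)
         (S-mono : ∀ k x → T (S k x) → T (S (suc k) x))
         (S-next : ∀ a b → S a ≗ S b → S (suc a) ≗ S (suc b)) where

  private
    size : ℕ → ℕ
    size k = length (filterᵇ (S k) (allFin n))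

  Stable : ℕ → Set
  Stable j = S (suc j) ≗ S j

  stable-forever : ∀ {j} → Stable j → ∀ i → S (i ℕ.+ j) ≗ S j
  stable-forever st zero    x = refl
  stable-forever st (suc i) x = trans (S-next _ _ (stable-forever st i) x) (st x)

  -- A step that changes S adds a point, and there are only n points.
  size-grows : ∀ k → (∃ λ j → j ℕ.< k × Stable j) ⊎ k ℕ.≤ size k
  size-grows zero = inj₂ z≤n
  size-grows (suc k) with size-grows k
  ... | inj₁ (j , j<k , st) = inj₁ (j , ℕP.m<n⇒m<1+n j<k , st)
  ... | inj₂ k≤size with FinP.all? (λ y → S (suc k) y BoolP.≟ S k y)
  ...   | yes st = inj₁ (k , ℕP.n<1+n k , st)
  ...   | no ¬st with FinP.¬∀⟶∃¬ n _ (λ y → S (suc k) y BoolP.≟ S k y) ¬st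
  ...     | y , ne with bool-strict-increase (S k y) (S (suc k) y) ne (S-mono k y)
  ...       | old , new = inj₂ (ℕP.≤-<-trans k≤size
                 (length-filterᵇ-strict (S-mono k) (∈-allFin y) old new))

  stabilizes : ∃ λ j → j ℕ.≤ n × Stable j
  stabilizes with size-grows (suc n)
  ... | inj₁ (j , s≤s j≤n , st) = j , j≤n , st
  ... | inj₂ n<size = ⊥-elim (ℕP.<⇒≱ n<size
          (subst (size (suc n) ℕ.≤_) (ListP.length-tabulate id)
                 (ListP.length-filter (T? ∘ S (suc n)) (allFin n))))

  eventually-constant : ∀ {k} → n ℕ.≤ k → S k ≗ S n
  eventually-constant {k} n≤k x with stabilizes
  ... | j , j≤n , st = trans (settled k (ℕP.≤-trans j≤n n≤k)) (sym (settled n j≤n))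
    where
    settled : ∀ m → j ℕ.≤ m → S m x ≡ S j x
    settled m j≤m =
      subst (λ m → S m x ≡ S j x) (ℕP.m∸n+n≡m j≤m) (stable-forever st (m ℕ.∸ j) x)

module LeastElements {n : ℕ} (C : Fin n → Fin n → Bool)
  (C-refl : ∀ x → T (C x x))
  (C-sym : ∀ {x y} → T (C x y) → T (C y x))
  (C-trans : ∀ {x y z} → T (C x y) → T (C y z) → T (C x z)) where

  Least : Fin n → Set
  Least r = ∀ z → z Fin.< r → ¬ T (C r z)

  least-exists : ∀ y → ∃ λ r → Least r × T (C r y)
  least-exists y = descend y (<-wellFounded y) (C-refl y)
    where
    descend : ∀ x → Acc Fin._<_ x → T (C x y) → ∃ λ r → Least r × T (C r y)
    descend x (acc smaller) Cxy with FinP.any? (λ z → (z <? x) ×-dec T? (C x z))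
    ... | yes (z , z<x , Cxz) = descend z (smaller z<x) (C-trans (C-sym Cxz) Cxy)
    ... | no none             = x , (λ z z<x Cxz → none (z , z<x , Cxz)) , Cxy

  least-unique : ∀ {y r r′} → Least r → T (C r y) → Least r′ → T (C r′ y) → r ≡ r′
  least-unique {r = r} {r′} least-r Cry least-r′ Cr′y with FinP.<-cmp r r′
  ... | tri< r<r′ _ _ = ⊥-elim (least-r′ r r<r′ (C-trans Cr′y (C-sym Cry)))
  ... | tri≈ _ r≡r′ _ = r≡r′
  ... | tri> _ _ r′<r = ⊥-elim (least-r r′ r′<r (C-trans Cry (C-sym Cr′y)))

module Components (G : OrientedHypergraph) (u₁ u₂ w₁ w₂ : Fin (nV G)) (c : Assignment G) where

  private
    R : ℕ → Fin (nV G) → Fin (nV G) → Bool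
    R = reach G u₁ u₂ w₁ w₂ c

    J : Fin (nV G) → Fin (nV G) → Bool
    J = joined G u₁ u₂ w₁ w₂ c

  reach-refl : ∀ k x → T (R k x x)
  reach-refl zero    x = fromWitness refl
  reach-refl (suc k) x = T-∨ .from (inj₁ (reach-refl k x))

  reach-mono : ∀ k {x y} → T (R k x y) → T (R (suc k) x y)
  reach-mono k p = T-∨ .from (inj₁ p)

  reach-step : ∀ k {x z y} → T (R k x z) → T (J z y) → T (R (suc k) x y)
  reach-step k {z = z} p q = T-∨ .from (inj₂ (any⁺ _ (lose (∈-allFin z) (T-∧ .from (p , q)))))

  reach-split : ∀ k {x y} → T (R (suc k) x y) → T (R k x y) ⊎ ∃ λ z → T (R k x z) × T (J z y)
  reach-split k p with T-∨ .to p
  ... | inj₁ q = inj₁ q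
  ... | inj₂ q with satisfied (any⁻ _ (allFin (nV G)) q)
  ...   | z , r = inj₂ (z , T-∧ .to r)

  reach-trans : ∀ a b {x y z} → T (R a x y) → T (R b y z) → T (R (b ℕ.+ a) x z)
  reach-trans a zero p q with toWitness q
  ... | refl = p
  reach-trans a (suc b) p q with reach-split b q
  ... | inj₁ q′           = reach-mono (b ℕ.+ a) (reach-trans a b p q′)
  ... | inj₂ (w , q′ , j) = reach-step (b ℕ.+ a) (reach-trans a b p q′) j

  joined-sym : ∀ {x y} → T (J x y) → T (J y x)
  joined-sym {x} {y} =
    subst T (BoolP.∨-comm (stepTo G u₁ u₂ w₁ w₂ c x y) (stepTo G u₁ u₂ w₁ w₂ c y x))

  reach-sym : ∀ k {x y} → T (R k x y) → T (R k y x)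
  reach-sym zero p with toWitness p
  ... | refl = reach-refl zero _
  reach-sym (suc k) {x} {y} p with reach-split k p
  ... | inj₁ q           = reach-mono k (reach-sym k q)
  ... | inj₂ (z , q , j) = subst (λ m → T (R m y x)) (ℕP.+-comm k 1)
    (reach-trans 1 k (reach-step 0 (reach-refl 0 y) (joined-sym j)) (reach-sym k q))

  reach-next : ∀ x a b → R a x ≗ R b x → R (suc a) x ≗ R (suc b) x
  reach-next x a b Ra≗Rb y =
    cong₂ _∨_ (Ra≗Rb y)
      (cong or (ListP.map-cong (λ z → cong (_∧ J z y) (Ra≗Rb z)) (allFin (nV G))))

  reach-eventually-constant : ∀ x {k} → nV G ℕ.≤ k → R k x ≗ R (nV G) x
  reach-eventually-constant x =
    IncreasingSubsets.eventually-constant (λ k → R k x) (λ k _ → reach-mono k) (reach-next x)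

  connected-trans : ∀ {x y z} → T (R (nV G) x y) → T (R (nV G) y z) → T (R (nV G) x z)
  connected-trans {x} {z = z} p q =
    subst T (reach-eventually-constant x (ℕP.m≤n+m (nV G) (nV G)) z) (reach-trans (nV G) (nV G) p q)

  open LeastElements (connected G u₁ u₂ w₁ w₂ c) (reach-refl (nV G)) (reach-sym (nV G)) connected-trans
    public

  isRep→Least : ∀ {r} → T (isRep G u₁ u₂ w₁ w₂ c r) → Least r
  isRep→Least rep z z<r Crz =
    subst T (T-not-≡ .to rep) (any⁺ _ (lose (∈-allFin z) (T-∧ .from (fromWitness z<r , Crz))))

  Least→isRep : ∀ {r} → Least r → T (isRep G u₁ u₂ w₁ w₂ c r)
  Least→isRep {r} least = T-not-≡ .from (BoolP.¬-not (no-smaller ∘ T-≡ .from))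
    where
    no-smaller : ¬ T (anyᵇ (λ z → ⌊ z <? r ⌋ ∧ connected G u₁ u₂ w₁ w₂ c r z) (allFin (nV G)))
    no-smaller found with satisfied (any⁻ _ (allFin (nV G)) found)
    ... | z , h with T-∧ .to h
    ...   | z<r , Crz = least z (toWitness z<r) Crz

module Parity (G : OrientedHypergraph) (u₁ u₂ w₁ w₂ : Fin (nV G)) where

  signAt : Assignment G → Fin (nV G) → Sign
  signAt c y = stepSign G u₁ u₂ w₁ w₂ (c y)

  backstepSign : Maybe (Step (nI G)) → Sign
  backstepSign m = if isBack G u₁ u₂ w₁ w₂ m then Sign.- else Sign.+

  isNeg-sign : ∀ s → (if isNeg G u₁ u₂ w₁ w₂ s then Sign.- else Sign.+) ≡ s
  isNeg-sign Sign.+ = refl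
  isNeg-sign Sign.- = refl

  module _ (c : Assignment G) where
    open Components G u₁ u₂ w₁ w₂ c

    private
      Rep : Fin (nV G) → Bool
      Rep = isRep G u₁ u₂ w₁ w₂ c

      C : Fin (nV G) → Fin (nV G) → Bool
      C = connected G u₁ u₂ w₁ w₂ c

      negativeRep : Fin (nV G) → Bool
      negativeRep x = Rep x ∧ isNeg G u₁ u₂ w₁ w₂ (compSign G u₁ u₂ w₁ w₂ c x)

    component-sign : ∀ x → (if negativeRep x then Sign.- else Sign.+)
                             ≡ ∏ (λ y → if Rep x ∧ C x y then signAt c y else Sign.+)
    component-sign x with Rep x
    ... | true  = trans (isNeg-sign _) (∏ᴸ-filterᵇ-allFin (C x) (signAt c))
    ... | false = sym (∏-replicate-+ (nV G))

    one-representative : ∀ y →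
      ∏ (λ x → if Rep x ∧ C x y then signAt c y else Sign.+) ≡ signAt c y
    one-representative y with least-exists y
    ... | r , least-r , Cry = ∏-single (λ x → Rep x ∧ C x y) (signAt c y)
            (T-∧ .from (Least→isRep least-r , Cry))
            (λ x p → let rep , Cxy = T-∧ .to p in least-unique (isRep→Least rep) Cxy least-r Cry)

    nc-parity : nc G u₁ u₂ w₁ w₂ c · Sign.- ≡ ∏ (signAt c)
    nc-parity = begin
      nc G u₁ u₂ w₁ w₂ c · Sign.-                                   ≡⟨ count-parity negativeRep ⟩
      ∏ (λ x → if negativeRep x then Sign.- else Sign.+)            ≡⟨ ∏-cong component-sign ⟩
      ∏ (λ x → ∏ (λ y → if Rep x ∧ C x y then signAt c y else Sign.+)) ≡⟨ ∏-comm {nV G} {nV G} _ ⟩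
      ∏ (λ y → ∏ (λ x → if Rep x ∧ C x y then signAt c y else Sign.+)) ≡⟨ ∏-cong one-representative ⟩
      ∏ (signAt c)                                                  ∎
      where open ≡-Reasoning

  stepWeight : Maybe (Step (nI G)) → Sign
  stepWeight m = stepSign G u₁ u₂ w₁ w₂ m Sign.* backstepSign m

  specialSign : Fin (nV G) → Sign
  specialSign v = if isSpecial G u₁ u₂ w₁ w₂ v then Sign.+ else Sign.-

  stepAt-weight : AllAdjacenciesNegative G → ∀ {k s} → IsStepAt G k s → stepWeight (just s) ≡ Sign.-
  stepAt-weight neg {s = adj i j} (_ , adjacent) = trans (SignP.*-identityʳ _) (neg i j adjacent)
  stepAt-weight neg {s = back i}  _              = refl

  options-weight : AllAdjacenciesNegative G → ∀ k → All (λ m → stepWeight m ≡ specialSign k)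
    (if isSpecial G u₁ u₂ w₁ w₂ k then nothing ∷ [] else map just (stepsAt G k))
  options-weight neg k with isSpecial G u₁ u₂ w₁ w₂ k
  ... | true  = refl ∷ []
  ... | false =
    AllP.map⁺ (All.map (stepAt-weight neg) (AllP.all-filter (isStepAt? G k) (allSteps G)))

  indicator : Fin (nV G) → Fin (nV G) → Sign
  indicator u y = if ⌊ y ≟ u ⌋ then Sign.- else Sign.+

  ∏-indicator : ∀ u → ∏ (indicator u) ≡ Sign.-
  ∏-indicator u = ∏-single (λ y → ⌊ y ≟ u ⌋) Sign.- (fromWitness refl) (λ _ → toWitness)

  specialSign-split : u₁ ≢ u₂ → ∀ y →
    specialSign y ≡ indicator u₁ y Sign.* (indicator u₂ y Sign.* Sign.-)
  specialSign-split u₁≢u₂ y with y ≟ u₁ | y ≟ u₂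
  ... | yes y≡u₁ | yes y≡u₂ = ⊥-elim (u₁≢u₂ (trans (sym y≡u₁) y≡u₂))
  ... | yes _    | no _     = refl
  ... | no _     | yes _    = refl
  ... | no _     | no _     = refl

  ∏-specialSign : u₁ ≢ u₂ → ∏ specialSign ≡ nV G · Sign.-
  ∏-specialSign u₁≢u₂ = begin
    ∏ specialSign
      ≡⟨ ∏-cong (specialSign-split u₁≢u₂) ⟩
    ∏ (λ y → indicator u₁ y Sign.* (indicator u₂ y Sign.* Sign.-))
      ≡⟨ ∏-distrib (indicator u₁) _ ⟩
    ∏ (indicator u₁) Sign.* ∏ (λ y → indicator u₂ y Sign.* Sign.-)
      ≡⟨ cong (∏ (indicator u₁) Sign.*_) (∏-distrib (indicator u₂) _) ⟩
    ∏ (indicator u₁) Sign.* (∏ (indicator u₂) Sign.* ∏ minus)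
      ≡⟨ cong₂ (λ a b → a Sign.* (b Sign.* ∏ minus)) (∏-indicator u₁) (∏-indicator u₂) ⟩
    Sign.- Sign.* (Sign.- Sign.* ∏ minus)
      ≡⟨ SignP.opposite-involutive _ ⟩
    ∏ minus
      ≡⟨ ∏-replicate (nV G) ⟩
    nV G · Sign.-
      ∎
    where
    open ≡-Reasoning
    minus : Fin (nV G) → Sign
    minus _ = Sign.-

  sgnP-constant : u₁ ≢ u₂ → ∀ c → (∀ k → stepWeight (c k) ≡ specialSign k) →
    sgnP G u₁ u₂ w₁ w₂ c ≡ -1ℤ ^ nV G
  sgnP-constant u₁≢u₂ c weights = begin
    -1ℤ ^ (nc′ ℕ.+ bs′)             ≡⟨ -1^≡◃ (nc′ ℕ.+ bs′) ⟩
    ((nc′ ℕ.+ bs′) · Sign.-) ◃ 1    ≡⟨ cong (_◃ 1) parity ⟩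
    (nV G · Sign.-) ◃ 1             ≡⟨ -1^≡◃ (nV G) ⟨
    -1ℤ ^ nV G                      ∎
    where
    open ≡-Reasoning
    nc′ bs′ : ℕ
    nc′ = nc G u₁ u₂ w₁ w₂ c
    bs′ = bs G u₁ u₂ w₁ w₂ c

    backstep : Fin (nV G) → Bool
    backstep y = isBack G u₁ u₂ w₁ w₂ (c y)

    parity : (nc′ ℕ.+ bs′) · Sign.- ≡ nV G · Sign.-
    parity = begin
      (nc′ ℕ.+ bs′) · Sign.-                          ≡⟨ ·-homo-+ Sign.- nc′ bs′ ⟩
      nc′ · Sign.- Sign.* bs′ · Sign.-                ≡⟨ cong₂ Sign._*_ (nc-parity c) (count-parity backstep) ⟩
      ∏ (signAt c) Sign.* ∏ (backstepSign ∘ c)        ≡⟨ ∏-distrib (signAt c) (backstepSign ∘ c) ⟨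
      ∏ (λ y → stepWeight (c y))                      ≡⟨ ∏-cong weights ⟩
      ∏ specialSign                                   ≡⟨ ∏-specialSign u₁≢u₂ ⟩
      nV G · Sign.-                                   ∎

  sgnP-on-Ĉ : AllAdjacenciesNegative G → u₁ ≢ u₂ →
    All (λ c → sgnP G u₁ u₂ w₁ w₂ c ≡ -1ℤ ^ nV G) (Ĉ G u₁ u₂ w₁ w₂)
  sgnP-on-Ĉ neg u₁≢u₂ = AllP.filter⁺ (λ c → isBijection? G u₁ u₂ w₁ w₂ (π G u₁ u₂ w₁ w₂ c))
    (All.map (sgnP-constant u₁≢u₂ _) (choiceFunctions-All (options-weight neg)))

corollary5p3 : (G : OrientedHypergraph) → AllAdjacenciesNegative G →
    (u₁ u₂ w₁ w₂ : Fin (nV G)) → u₁ ≢ u₂ →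
    bracketP G u₁ u₂ w₁ w₂ ≡ (-1ℤ ^ nV G) * (+ length (Ĉ G u₁ u₂ w₁ w₂))
corollary5p3 G neg u₁ u₂ w₁ w₂ u₁≢u₂ =
  sum-const (sgnP G u₁ u₂ w₁ w₂) (Parity.sgnP-on-Ĉ G u₁ u₂ w₁ w₂ neg u₁≢u₂)
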